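{- Let $\Gamma$ be a RelPf context, $t,t'$ terms, $R$ a relational type, and $\gamma$ an environment defined on all free type variables of $\Gamma$ and $R$. If $\Gamma\vdash t\,[R]\,t'$ is derivable in RelPf and $\sigma\in\llbracket\Gamma\rrbracket_\gamma$, then $\sigma\,t\ \llbracket \sigma\,R\rrbracket_\gamma\ \sigma\,t'$.
   Context: Terms are those of the pure untyped $\lambda$-calculus, up to $\alpha$-equivalence; $=_{\beta\eta}$ is $\beta\eta$-convertibility. Relational types: $R ::= X \mid R\to R' \mid \forall X.R \mid R^{\cup} \mid R\cdot R' \mid t$ (last form: promotion of a term). A relation on terms is $\beta\eta$-closed if it is closed under replacing either related term by a $\beta\eta$-equal one; $\mathcal{R}$ is the set of such relations; environments $\gamma$ map finitely many type variables to $\mathcal{R}$. Interpretation: $\llbracket X\rrbracket_\gamma=\gamma(X)$; $t\,\llbracket R\to R'\rrbracket_\gamma\,t'$ iff for all $a,a'$ with $a\,\llbracket R\rrbracket_\gamma\,a'$, $t\,a\,\llbracket R'\rrbracket_\gamma\,t'\,a'$; $\llbracket \forall X.R\rrbracket_\gamma=\bigcap_{r\in\mathcal{R}}\llbracket R\rrbracket_{\gamma[X\mapsto r]}$; $t\,\llbracket R^\cup\rrbracket_\gamma\,t'$ iff $t'\,\llbracket R\rrbracket_\gamma\,t$; $t\,\llbracket R\cdot R'\rrbracket_\gamma\,t'$ iff $\exists t''$, $t\,\llbracket R\rrbracket_\gamma\,t''$ and $t''\,\llbracket R'\rrbracket_\gamma\,t'$; $\llbracket \hat t\rrbracket_\gamma=\{(t,t')\mid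 \hat t\,t=_{\beta\eta}t'\}$. RelPf: contexts $\Gamma ::= \cdot \mid \Gamma, t\,[R]\,t'$; judgments $\Gamma\vdash t\,[R]\,t'$ derived by the rules: (assumption) $\Gamma\vdash t[R]t'$ if $t[R]t'\in\Gamma$; ($\to$I) from $\Gamma, x[R]x'\vdash t[R']t'$ infer $\Gamma\vdash \lambda x.t\,[R\to R']\,\lambda x'.t'$, provided $x,x'\notin\mathrm{FV}(\Gamma,R,R')$; ($\to$E) from $\Gamma\vdash t[R\to R']t'$ and $\Gamma\vdash t_1[R]t_2$ infer $\Gamma\vdash t\,t_1\,[R']\,t'\,t_2$; ($\forall$E) from $\Gamma\vdash t[\forall X.R']t'$ infer $\Gamma\vdash t[[R/X]R']t'$; ($\forall$I) from $\Gamma\vdash t[R]t'$ with $X\notin\mathrm{FV}(\Gamma)$ infer $\Gamma\vdash t[\forall X.R]t'$; (conversion) from $\Gamma\vdash t_1[R]t_2$, $t_1=_{\beta\eta}t_1'$, $t_2=_{\beta\eta}t_2'$ infer $\Gamma\vdash t_1'[R]t_2'$; ($\cup$I) from $\Gamma\vdash t'[R]t$ infer $\Gamma\vdash t[R^\cup]t'$; ($\cup$E) from $\Gamma\vdash t[R^\cup]t'$ infer $\Gamma\vdash t'[R]t$; (promotion I) $\Gamma\vdash t\,[t']\,t'\,t$ (axiom); (promotion E) from $\Gamma\vdash t[t'']t'$ and $\Gamma\vdash [t'/x]t_1\,[R]\,[t'/x]t_2$ infer $\Gamma\vdash [t''\,t/x]t_1\,[R]\,[t''\,t/x]t_2$;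 ($\cdot$E) from $\Gamma\vdash t[R\cdot R']t'$ and $\Gamma, t[R]x, x[R']t'\vdash t_1[R'']t_2$ infer $\Gamma\vdash t_1[R'']t_2$, provided $x\notin\mathrm{FV}(\Gamma,t_1,t_2,t,t',R,R',R'')$; ($\cdot$I) from $\Gamma\vdash t[R]t''$ and $\Gamma\vdash t''[R']t'$ infer $\Gamma\vdash t[R\cdot R']t'$. A term substitution $\sigma$ is a finite map from term variables to terms, applied capture-avoidingly to terms and to types (acting on all terms occurring in a type). $\llbracket\Gamma\rrbracket_\gamma$: every $\sigma$ is in $\llbracket\cdot\rrbracket_\gamma$, and $\sigma\in\llbracket\Gamma,t[R]t'\rrbracket_\gamma$ iff $\sigma\in\llbracket\Gamma\rrbracket_\gamma$ and $\sigma t\,\llbracket\sigma R\rrbracket_\gamma\,\sigma t'$.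
   Formalization: In rule (→I), x and x' are taken distinct, with x not free in t' and x' not free in t; under the stated side condition alone, λx.x' [X→X^∪] λx'.x would be derivable in the empty context and the claim would fail. -}

module Defs where

open import Level using (Level; Lift; 0ℓ) renaming (suc to lsuc)
open import Axiom.ExcludedMiddle using (ExcludedMiddle)
open import Data.Empty using (⊥; ⊥-elim)
open import Data.List.Base using (List; []; _∷_; map)
open import Data.List.Membership.Propositional using (_∈_)
open import Data.List.Relation.Unary.All using (All)
open import Data.Maybe.Base using (Maybe; just; nothing; fromMaybe; maybe′)
open import Data.Maybe using (Is-just)
open import Data.Nat.Base using (ℕ; zero; suc)
open import Data.Product using (Σ; ∃; _×_; _,_; proj₁)
open import Data.Unit.Base using (⊤; tt)
open import Function.Bundles using (_⇔_; mk⇔)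
open import Relation.Binary.Core using (Rel)
open import Relation.Binary.Definitions using (_Respects₂_)
open import Relation.Binary.Construct.Closure.Equivalence using (EqClosure)
open import Relation.Nullary using (yes; no)

infixl 9 _·_
infixl 10 _[0≔_] _[0≔_]ᵗ
infixr 7 _⇒_
infixl 8 _⨾_
infixl 9 _˘
infix  6 _[_]_
infix  4 _⟶_ _=βη_ _⊢_ _free-in_ _∈⟦_⟧_ _defined-on_

private
  variable
    a : Level
    A : Set a

-- Finite partial maps from ℕ: an index is mapped to x if `just x` is
-- listed at its position, and is outside the domain otherwise.

FinMap : Set a → Set a
FinMap A = List (Maybe A)

_!_ : FinMap A → ℕ → Maybe A
[]      ! _     = nothing
(m ∷ _) ! zero  = m
(_ ∷ f) ! suc n = f ! n

-- Untyped λ-terms up to α: de Bruijn indices. There is no scope bound, so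
-- that infinitely many free variables are always available.

data Term : Set where
  var : ℕ → Term
  _·_ : Term → Term → Term
  ƛ   : Term → Term

extʳ : (ℕ → ℕ) → ℕ → ℕ
extʳ ρ zero    = zero
extʳ ρ (suc n) = suc (ρ n)

ren : (ℕ → ℕ) → Term → Term
ren ρ (var n) = var (ρ n)
ren ρ (t · u) = ren ρ t · ren ρ u
ren ρ (ƛ t)   = ƛ (ren (extʳ ρ) t)

exts : (ℕ → Term) → ℕ → Term
exts s zero    = var zero
exts s (suc n) = ren suc (s n)

sub : (ℕ → Term) → Term → Term
sub s (var n) = s n
sub s (t · u) = sub s t · sub s u
sub s (ƛ t)   = ƛ (sub (exts s) t)

inst : Term → ℕ → Term
inst u zero    = u
inst u (suc n) = var n

_[0≔_] : Term → Term → Term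
t [0≔ u ] = sub (inst u) t

data _⟶_ : Rel Term 0ℓ where
  β    : ∀ {t u}    → ƛ t · u ⟶ t [0≔ u ]
  η    : ∀ {t}      → ƛ (ren suc t · var zero) ⟶ t
  appˡ : ∀ {t t′ u} → t ⟶ t′ → t · u ⟶ t′ · u
  appʳ : ∀ {t u u′} → u ⟶ u′ → t · u ⟶ t · u′
  lam  : ∀ {t t′}   → t ⟶ t′ → ƛ t ⟶ ƛ t′

_=βη_ : Rel Term 0ℓ
_=βη_ = EqClosure _⟶_

-- Type variables are de Bruijn indices of their own, bound by `∀.
-- Types never bind term variables.

data Ty : Set where
  tvar : ℕ → Ty
  _⇒_  : Ty → Ty → Ty
  `∀   : Ty → Ty
  _˘   : Ty → Ty
  _⨾_  : Ty → Ty → Ty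
  ⌜_⌝  : Term → Ty

data _free-in_ : ℕ → Ty → Set where
  tvar : ∀ {X}      → X free-in tvar X
  ⇒ˡ   : ∀ {X R R′} → X free-in R → X free-in R ⇒ R′
  ⇒ʳ   : ∀ {X R R′} → X free-in R′ → X free-in R ⇒ R′
  `∀   : ∀ {X R}    → suc X free-in R → X free-in `∀ R
  _˘   : ∀ {X R}    → X free-in R → X free-in R ˘
  ⨾ˡ   : ∀ {X R R′} → X free-in R → X free-in R ⨾ R′
  ⨾ʳ   : ∀ {X R R′} → X free-in R′ → X free-in R ⨾ R′

mapTm : (Term → Term) → Ty → Ty
mapTm f (tvar X) = tvar X
mapTm f (R ⇒ R′) = mapTm f R ⇒ mapTm f R′
mapTm f (`∀ R)   = `∀ (mapTm f R)
mapTm f (R ˘)    = mapTm f R ˘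
mapTm f (R ⨾ R′) = mapTm f R ⨾ mapTm f R′
mapTm f ⌜ t ⌝    = ⌜ f t ⌝

renᵗ : (ℕ → ℕ) → Ty → Ty
renᵗ ρ (tvar X) = tvar (ρ X)
renᵗ ρ (R ⇒ R′) = renᵗ ρ R ⇒ renᵗ ρ R′
renᵗ ρ (`∀ R)   = `∀ (renᵗ (extʳ ρ) R)
renᵗ ρ (R ˘)    = renᵗ ρ R ˘
renᵗ ρ (R ⨾ R′) = renᵗ ρ R ⨾ renᵗ ρ R′
renᵗ ρ ⌜ t ⌝    = ⌜ t ⌝

extsᵗ : (ℕ → Ty) → ℕ → Ty
extsᵗ s zero    = tvar zero
extsᵗ s (suc X) = renᵗ suc (s X)

subᵗ : (ℕ → Ty) → Ty → Ty
subᵗ s (tvar X) = s X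
subᵗ s (R ⇒ R′) = subᵗ s R ⇒ subᵗ s R′
subᵗ s (`∀ R)   = `∀ (subᵗ (extsᵗ s) R)
subᵗ s (R ˘)    = subᵗ s R ˘
subᵗ s (R ⨾ R′) = subᵗ s R ⨾ subᵗ s R′
subᵗ s ⌜ t ⌝    = ⌜ t ⌝

instᵗ : Ty → ℕ → Ty
instᵗ S zero    = S
instᵗ S (suc X) = tvar X

_[0≔_]ᵗ : Ty → Ty → Ty
R [0≔ S ]ᵗ = subᵗ (instᵗ S) R

𝓡 : Set₁
𝓡 = Σ (Rel Term 0ℓ) (_Respects₂ _=βη_)

Env : Set₁
Env = FinMap 𝓡

-- The value at a variable outside the domain of the environment (the empty
-- relation) is a dummy.

⟦_⟧ : Ty → Env → Rel Term (lsuc 0ℓ)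
⟦ tvar X ⟧ γ t t′ = Lift _ (maybe′ (λ r → proj₁ r t t′) ⊥ (γ ! X))
⟦ R ⇒ R′ ⟧ γ t t′ = ∀ a a′ → ⟦ R ⟧ γ a a′ → ⟦ R′ ⟧ γ (t · a) (t′ · a′)
⟦ `∀ R ⟧   γ t t′ = ∀ (r : 𝓡) → ⟦ R ⟧ (just r ∷ γ) t t′
⟦ R ˘ ⟧    γ t t′ = ⟦ R ⟧ γ t′ t
⟦ R ⨾ R′ ⟧ γ t t′ = ∃ λ t″ → ⟦ R ⟧ γ t t″ × ⟦ R′ ⟧ γ t″ t′
⟦ ⌜ s ⌝ ⟧  γ t t′ = Lift _ (s · t =βη t′)

record Assertion : Set where
  constructor _[_]_
  field
    left  : Term
    type  : Ty
    right : Term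

open Assertion public

-- The most recent assertion comes first: Γ , t [ R ] t′ is (t [ R ] t′) ∷ Γ.

Ctx : Set
Ctx = List Assertion

mapTmᵃ : (Term → Term) → Assertion → Assertion
mapTmᵃ f (t [ R ] t′) = f t [ mapTm f R ] f t′

shiftᵗ : Ctx → Ctx
shiftᵗ = map λ (t [ R ] t′) → t [ renᵗ suc R ] t′

shift : ℕ → Term → Term
shift zero    t = t
shift (suc n) t = ren suc (shift n t)

-- Freshness side conditions become shifts.
--
-- In ⇒I the fresh variables x and x′ are the indices 1 and 0 of the
-- premise. They are distinct, x does not occur in t′ and x′ does not occur
-- in t (without this the rule is unsound: x [ R ] x′ ⊢ x′ [ R ˘ ] x would
-- give λx.x′ [ R ⇒ R ˘ ] λx′.x with x′ and x free on the left and on the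
-- right). Index 0 of the bodies t, t′ is renamed to 1 and 0 respectively.

data _⊢_ (Γ : Ctx) : Assertion → Set where

  assume : ∀ {t R t′} →
           t [ R ] t′ ∈ Γ →
           Γ ⊢ t [ R ] t′

  ⇒I     : ∀ {t t′ R R′} →
           var 1 [ mapTm (shift 2) R ] var 0 ∷ map (mapTmᵃ (shift 2)) Γ
             ⊢ ren suc t [ mapTm (shift 2) R′ ] ren (extʳ suc) t′ →
           Γ ⊢ ƛ t [ R ⇒ R′ ] ƛ t′

  ⇒E     : ∀ {t t′ t₁ t₂ R R′} →
           Γ ⊢ t [ R ⇒ R′ ] t′ →
           Γ ⊢ t₁ [ R ] t₂ →
           Γ ⊢ t · t₁ [ R′ ] t′ · t₂

  ∀E     : ∀ {t t′ R′} R →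
           Γ ⊢ t [ `∀ R′ ] t′ →
           Γ ⊢ t [ R′ [0≔ R ]ᵗ ] t′

  ∀I     : ∀ {t t′ R} →
           shiftᵗ Γ ⊢ t [ R ] t′ →
           Γ ⊢ t [ `∀ R ] t′

  conv   : ∀ {t₁ t₁′ t₂ t₂′ R} →
           Γ ⊢ t₁ [ R ] t₂ →
           t₁ =βη t₁′ →
           t₂ =βη t₂′ →
           Γ ⊢ t₁′ [ R ] t₂′

  ˘I     : ∀ {t t′ R} →
           Γ ⊢ t′ [ R ] t →
           Γ ⊢ t [ R ˘ ] t′

  ˘E     : ∀ {t t′ R} →
           Γ ⊢ t [ R ˘ ] t′ →
           Γ ⊢ t′ [ R ] t

  ⌜⌝I    : ∀ {t t′} →
           Γ ⊢ t [ ⌜ t′ ⌝ ] t′ · t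

  ⌜⌝E    : ∀ {t t′ t″ R} t₁ t₂ →
           Γ ⊢ t [ ⌜ t″ ⌝ ] t′ →
           Γ ⊢ t₁ [0≔ t′ ] [ R ] t₂ [0≔ t′ ] →
           Γ ⊢ t₁ [0≔ t″ · t ] [ R ] t₂ [0≔ t″ · t ]

  ⨾E     : ∀ {t t′ t₁ t₂ R R′ R″} →
           Γ ⊢ t [ R ⨾ R′ ] t′ →
           var 0 [ mapTm (shift 1) R′ ] shift 1 t′
             ∷ shift 1 t [ mapTm (shift 1) R ] var 0
             ∷ map (mapTmᵃ (shift 1)) Γ
             ⊢ shift 1 t₁ [ mapTm (shift 1) R″ ] shift 1 t₂ →
           Γ ⊢ t₁ [ R″ ] t₂

  ⨾I     : ∀ {t t′ t″ R R′} →
           Γ ⊢ t [ R ] t″ →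
           Γ ⊢ t″ [ R′ ] t′ →
           Γ ⊢ t [ R ⨾ R′ ] t′

TermSubst : Set
TermSubst = FinMap Term

-- Variables outside the domain are left unchanged; range terms live in the
-- same scope as the substituted term.

_$ₜ_ : TermSubst → Term → Term
σ $ₜ t = sub (λ n → fromMaybe (var n) (σ ! n)) t

_$ᵀ_ : TermSubst → Ty → Ty
σ $ᵀ R = mapTm (σ $ₜ_) R

_∈⟦_⟧_ : TermSubst → Ctx → Env → Set₁
σ ∈⟦ Γ ⟧ γ =
  All (λ φ → ⟦ σ $ᵀ type φ ⟧ γ (σ $ₜ left φ) (σ $ₜ right φ)) Γ

_defined-on_ : Env → Ty → Set₁
γ defined-on R = ∀ {X} → X free-in R → Is-just (γ ! X)

-- Propositional resizing.  The interpretation of `∀ is impredicative: the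
-- interpretation of any type, in particular of `∀ R itself, must again be
-- (up to logical equivalence) an element of 𝓡.  Agda's universes are
-- predicative, so this is a hypothesis; it holds classically.

Resizing : Set₂
Resizing = (A : Set₁) → ∃ λ (B : Set) → A ⇔ B

em⇒resizing : ExcludedMiddle (lsuc 0ℓ) → Resizing
em⇒resizing em A with em {A}
... | yes a = ⊤ , mk⇔ (λ _ → tt) (λ _ → a)
... | no ¬a = ⊥ , mk⇔ ¬a ⊥-elim

{-# OPTIONS --safe #-}
-- Induction on the derivation, for substitutions given by arbitrary functions
-- ℕ → Term: the rules that bind variables then extend the substitution by the
-- related terms. Three facts about the interpretation carry the argument: it is
-- βη-closed, it is stable under weakening of the environment, and substituting
-- a type for a variable amounts to updating the environment with its
-- interpretation (an element of 𝓡 by resizing).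
module Submission where

open import Defs
open import Data.List.Base using (_∷_; map)
open import Data.List.Relation.Unary.All using (All; _∷_; lookup) renaming (map to mapAll)
open import Data.List.Relation.Unary.All.Properties using (map⁺)
open import Data.Maybe.Base using (just; nothing)
open import Data.Nat.Base using (ℕ; zero; suc)
open import Data.Product using (∃; _×_; _,_; proj₁; proj₂)
open import Function.Base using (_∘_; flip)
open import Function.Bundles using (_⇔_; mk⇔; Equivalence)
open import Function.Construct.Composition using (_⇔-∘_)
open import Function.Construct.Identity using (⇔-id)
open import Level using (0ℓ; lift; lower) renaming (suc to lsuc)
open import Relation.Binary.Core using (Rel)
open import Relation.Binary.Construct.Closure.Equivalence
  using (gmap; return; reflexive; symmetric; transitive)
open import Relation.Binary.PropositionalEquality
  using (_≡_; refl; sym; trans; cong; cong₂; subst; subst₂)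

open Equivalence using (to; from)

-- Calculus of renamings and substitutions

-- The composite is a separate parameter, constrained pointwise, so that no function extensionality
-- is needed: under a binder the constraint is re-proved index by index.
ren-ren : ∀ {ρ ρ′ ρ″} → (∀ n → ρ (ρ′ n) ≡ ρ″ n) →
          ∀ t → ren ρ (ren ρ′ t) ≡ ren ρ″ t
ren-ren eq (var n) = cong var (eq n)
ren-ren eq (t · u) = cong₂ _·_ (ren-ren eq t) (ren-ren eq u)
ren-ren eq (ƛ t)   = cong ƛ (ren-ren (λ where
  zero    → refl
  (suc n) → cong suc (eq n)) t)

sub-ren : ∀ {s ρ τ} → (∀ n → s (ρ n) ≡ τ n) →
          ∀ t → sub s (ren ρ t) ≡ sub τ t
sub-ren eq (var n) = eq n
sub-ren eq (t · u) = cong₂ _·_ (sub-ren eq t) (sub-ren eq u)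
sub-ren eq (ƛ t)   = cong ƛ (sub-ren (λ where
  zero    → refl
  (suc n) → cong (ren suc) (eq n)) t)

ren-sub : ∀ {ρ s τ} → (∀ n → ren ρ (s n) ≡ τ n) →
          ∀ t → ren ρ (sub s t) ≡ sub τ t
ren-sub eq (var n) = eq n
ren-sub eq (t · u) = cong₂ _·_ (ren-sub eq t) (ren-sub eq u)
ren-sub {ρ} {s} eq (ƛ t) = cong ƛ (ren-sub (λ where
  zero    → refl
  -- Both `ren (extʳ ρ) ∘ ren suc` and `ren suc ∘ ren ρ` rename by `suc ∘ ρ`.
  (suc n) → trans (ren-ren (λ _ → refl) (s n))
              (trans (sym (ren-ren (λ _ → refl) (s n))) (cong (ren suc) (eq n)))) t)

sub-exts-ren : ∀ s t → sub (exts s) (ren suc t) ≡ ren suc (sub s t)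
sub-exts-ren s t = trans (sub-ren (λ _ → refl) t) (sym (ren-sub (λ _ → refl) t))

sub-sub : ∀ {τ s υ} → (∀ n → sub τ (s n) ≡ υ n) →
          ∀ t → sub τ (sub s t) ≡ sub υ t
sub-sub eq (var n) = eq n
sub-sub eq (t · u) = cong₂ _·_ (sub-sub eq t) (sub-sub eq u)
sub-sub {τ} {s} eq (ƛ t) = cong ƛ (sub-sub (λ where
  zero    → refl
  (suc n) → trans (sub-exts-ren τ (s n)) (cong (ren suc) (eq n))) t)

sub-var : ∀ {s} → (∀ n → s n ≡ var n) → ∀ t → sub s t ≡ t
sub-var eq (var n) = eq n
sub-var eq (t · u) = cong₂ _·_ (sub-var eq t) (sub-var eq u)
sub-var eq (ƛ t)   = cong ƛ (sub-var (λ where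
  zero    → refl
  (suc n) → cong (ren suc) (eq n)) t)

infixr 5 _∙_

_∙_ : Term → (ℕ → Term) → ℕ → Term
(u ∙ s) zero    = u
(u ∙ s) (suc n) = s n

sub-exts-[0≔] : ∀ s u t → sub (exts s) t [0≔ u ] ≡ sub (u ∙ s) t
sub-exts-[0≔] s u = sub-sub λ where
  zero    → refl
  -- Weakening `s n` and then instantiating index 0 cancel.
  (suc n) → trans (sub-ren (λ _ → refl) (s n)) (sub-var (λ _ → refl) (s n))

-- Both sides equal `sub (sub s u ∙ s) t`. This is what makes β-steps stable under substitution.
sub-[0≔] : ∀ s u t → sub s (t [0≔ u ]) ≡ sub (exts s) t [0≔ sub s u ]
sub-[0≔] s u t = trans
  (sub-sub (λ { zero → refl ; (suc _) → refl }) t)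
  (sym (sub-exts-[0≔] s (sub s u) t))

-- βη-convertibility

·-cong : ∀ {t t′ u u′} → t =βη t′ → u =βη u′ → t · u =βη t′ · u′
·-cong {t′ = t′} {u = u} p q =
  transitive _⟶_ (gmap (_· u) appˡ p) (gmap (t′ ·_) appʳ q)

≡⇒=βη : ∀ {t u} → t ≡ u → t =βη u
≡⇒=βη refl = reflexive _⟶_

sub-⟶ : ∀ s {t u} → t ⟶ u → sub s t ⟶ sub s u
sub-⟶ s (β {t} {u}) = subst (sub s (ƛ t · u) ⟶_) (sym (sub-[0≔] s u t)) β
sub-⟶ s (η {t})     =
  subst (λ b → ƛ (b · var zero) ⟶ sub s t) (sym (sub-exts-ren s t)) η
sub-⟶ s (appˡ r)    = appˡ (sub-⟶ s r)
sub-⟶ s (appʳ r)    = appʳ (sub-⟶ s r)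
sub-⟶ s (lam r)     = lam (sub-⟶ (exts s) r)

sub-=βη : ∀ s {t u} → t =βη u → sub s t =βη sub s u
sub-=βη s = gmap (sub s) (sub-⟶ s)

-- Both sides are contracta of ƛ t · u and ƛ t · v.
[0≔]-cong : ∀ t {u v} → u =βη v → t [0≔ u ] =βη t [0≔ v ]
[0≔]-cong t p = transitive _⟶_ (symmetric _⟶_ (return (β {t})))
  (transitive _⟶_ (·-cong (reflexive _⟶_) p) (return (β {t})))

-- Term maps on types

mapTm-∘ : ∀ {f g h : Term → Term} → (∀ t → f (g t) ≡ h t) →
          ∀ R → mapTm f (mapTm g R) ≡ mapTm h R
mapTm-∘ eq (tvar X) = refl
mapTm-∘ eq (R ⇒ R′) = cong₂ _⇒_ (mapTm-∘ eq R) (mapTm-∘ eq R′)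
mapTm-∘ eq (`∀ R)   = cong `∀ (mapTm-∘ eq R)
mapTm-∘ eq (R ˘)    = cong _˘ (mapTm-∘ eq R)
mapTm-∘ eq (R ⨾ R′) = cong₂ _⨾_ (mapTm-∘ eq R) (mapTm-∘ eq R′)
mapTm-∘ eq ⌜ t ⌝    = cong ⌜_⌝ (eq t)

mapTm-renᵗ : ∀ f ρ R → mapTm f (renᵗ ρ R) ≡ renᵗ ρ (mapTm f R)
mapTm-renᵗ f ρ (tvar X) = refl
mapTm-renᵗ f ρ (R ⇒ R′) = cong₂ _⇒_ (mapTm-renᵗ f ρ R) (mapTm-renᵗ f ρ R′)
mapTm-renᵗ f ρ (`∀ R)   = cong `∀ (mapTm-renᵗ f (extʳ ρ) R)
mapTm-renᵗ f ρ (R ˘)    = cong _˘ (mapTm-renᵗ f ρ R)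
mapTm-renᵗ f ρ (R ⨾ R′) = cong₂ _⨾_ (mapTm-renᵗ f ρ R) (mapTm-renᵗ f ρ R′)
mapTm-renᵗ f ρ ⌜ t ⌝    = refl

mapTm-subᵗ : ∀ f {s τ} → (∀ X → mapTm f (s X) ≡ τ X) →
             ∀ R → mapTm f (subᵗ s R) ≡ subᵗ τ (mapTm f R)
mapTm-subᵗ f eq (tvar X) = eq X
mapTm-subᵗ f eq (R ⇒ R′) = cong₂ _⇒_ (mapTm-subᵗ f eq R) (mapTm-subᵗ f eq R′)
mapTm-subᵗ f {s} eq (`∀ R) = cong `∀ (mapTm-subᵗ f (λ where
  zero    → refl
  (suc X) → trans (mapTm-renᵗ f suc (s X)) (cong (renᵗ suc) (eq X))) R)
mapTm-subᵗ f eq (R ˘)    = cong _˘ (mapTm-subᵗ f eq R)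
mapTm-subᵗ f eq (R ⨾ R′) = cong₂ _⨾_ (mapTm-subᵗ f eq R) (mapTm-subᵗ f eq R′)
mapTm-subᵗ f eq ⌜ t ⌝    = refl

mapTm-[0≔]ᵗ : ∀ f S R → mapTm f (R [0≔ S ]ᵗ) ≡ mapTm f R [0≔ mapTm f S ]ᵗ
mapTm-[0≔]ᵗ f S = mapTm-subᵗ f λ { zero → refl ; (suc _) → refl }

mapTmᵃ-∘ : ∀ {f g h : Term → Term} → (∀ t → f (g t) ≡ h t) →
           ∀ φ → mapTmᵃ f (mapTmᵃ g φ) ≡ mapTmᵃ h φ
mapTmᵃ-∘ {h = h} eq (t [ R ] t′) =
  trans (cong₂ (λ u S → u [ S ] _) (eq t) (mapTm-∘ eq R)) (cong (h t [ mapTm h R ]_) (eq t′))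

-- Properties of the interpretation

⟦⟧-resp : ∀ R γ {t t′ u u′} → t =βη u → t′ =βη u′ →
          ⟦ R ⟧ γ t t′ → ⟦ R ⟧ γ u u′
⟦⟧-resp (tvar X) γ p q h with γ ! X
... | just (_ , respʳ , respˡ) = lift (respʳ q (respˡ p (lower h)))
-- Outside the domain the dummy value is the empty relation, which is vacuously closed.
... | nothing                  = lift (lower h)
⟦⟧-resp (R ⇒ R′) γ p q h a a′ r =
  ⟦⟧-resp R′ γ (·-cong p (reflexive _⟶_)) (·-cong q (reflexive _⟶_)) (h a a′ r)
⟦⟧-resp (`∀ R)   γ p q h r = ⟦⟧-resp R (just r ∷ γ) p q (h r)
⟦⟧-resp (R ˘)    γ p q h = ⟦⟧-resp R γ q p h
⟦⟧-resp (R ⨾ R′) γ p q (m , h , h′) =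
  m , ⟦⟧-resp R γ p (reflexive _⟶_) h , ⟦⟧-resp R′ γ (reflexive _⟶_) q h′
⟦⟧-resp ⌜ s ⌝    γ p q (lift h) = lift
  (transitive _⟶_ (·-cong (reflexive _⟶_) (symmetric _⟶_ p)) (transitive _⟶_ h q))

infix 4 _≃_

_≃_ : Rel Term (lsuc 0ℓ) → Rel Term (lsuc 0ℓ) → Set₁
P ≃ Q = ∀ t t′ → P t t′ ⇔ Q t t′

⇒-cong : ∀ {P P′ Q Q′} → P ≃ Q → P′ ≃ Q′ → ∀ t t′ →
         (∀ a a′ → P a a′ → P′ (t · a) (t′ · a′)) ⇔
         (∀ a a′ → Q a a′ → Q′ (t · a) (t′ · a′))
⇒-cong e e′ t t′ = mk⇔
  (λ h a a′ r → e′ _ _ .to (h a a′ (e a a′ .from r)))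
  (λ h a a′ r → e′ _ _ .from (h a a′ (e a a′ .to r)))

`∀-cong : ∀ {P Q : 𝓡 → Rel Term (lsuc 0ℓ)} → (∀ r → P r ≃ Q r) →
          (λ t t′ → ∀ r → P r t t′) ≃ (λ t t′ → ∀ r → Q r t t′)
`∀-cong e t t′ = mk⇔ (λ h r → e r t t′ .to (h r)) (λ h r → e r t t′ .from (h r))

⨾-cong : ∀ {P P′ Q Q′} → P ≃ Q → P′ ≃ Q′ →
         (λ t t′ → ∃ λ m → P t m × P′ m t′) ≃ (λ t t′ → ∃ λ m → Q t m × Q′ m t′)
⨾-cong e e′ t t′ = mk⇔
  (λ (m , h , h′) → m , e t m .to h , e′ m t′ .to h′)
  (λ (m , h , h′) → m , e t m .from h , e′ m t′ .from h′)

⟦renᵗ⟧ : ∀ {ρ} {γ δ : Env} → (∀ X → γ ! ρ X ≡ δ ! X) →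
         ∀ R → ⟦ renᵗ ρ R ⟧ γ ≃ ⟦ R ⟧ δ
⟦renᵗ⟧ eq (tvar X) t t′ rewrite eq X = ⇔-id _
⟦renᵗ⟧ eq (R ⇒ R′) = ⇒-cong (⟦renᵗ⟧ eq R) (⟦renᵗ⟧ eq R′)
⟦renᵗ⟧ eq (`∀ R)   = `∀-cong λ r → ⟦renᵗ⟧ (λ where
  zero    → refl
  (suc X) → eq X) R
⟦renᵗ⟧ eq (R ˘)    = flip (⟦renᵗ⟧ eq R)
⟦renᵗ⟧ eq (R ⨾ R′) = ⨾-cong (⟦renᵗ⟧ eq R) (⟦renᵗ⟧ eq R′)
⟦renᵗ⟧ eq ⌜ s ⌝    t t′ = mk⇔ (lift ∘ lower) (lift ∘ lower)

⟦subᵗ⟧ : ∀ {s γ δ} → (∀ X → ⟦ s X ⟧ γ ≃ ⟦ tvar X ⟧ δ) →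
         ∀ R → ⟦ subᵗ s R ⟧ γ ≃ ⟦ R ⟧ δ
⟦subᵗ⟧ e (tvar X) = e X
⟦subᵗ⟧ e (R ⇒ R′) = ⇒-cong (⟦subᵗ⟧ e R) (⟦subᵗ⟧ e R′)
⟦subᵗ⟧ {s} e (`∀ R) = `∀-cong λ r → ⟦subᵗ⟧ (λ where
  zero    _ _  → ⇔-id _
  -- The type variables of `s X` have been shifted past the new relation `r`, so its interpretation
  -- is still the one over `γ`.
  (suc X) t t′ → e X t t′ ⇔-∘ ⟦renᵗ⟧ (λ _ → refl) (s X) t t′) R
⟦subᵗ⟧ e (R ˘)    = flip (⟦subᵗ⟧ e R)
⟦subᵗ⟧ e (R ⨾ R′) = ⨾-cong (⟦subᵗ⟧ e R) (⟦subᵗ⟧ e R′)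
⟦subᵗ⟧ e ⌜ s ⌝    t t′ = mk⇔ (lift ∘ lower) (lift ∘ lower)

-- Soundness

Holds : Env → Assertion → Set₁
Holds γ φ = ⟦ type φ ⟧ γ (left φ) (right φ)

infix 4 _⊨_at_

_⊨_at_ : (ℕ → Term) → Ctx → Env → Set₁
s ⊨ Γ at γ = All (λ φ → Holds γ (mapTmᵃ (sub s) φ)) Γ

⊨-map : ∀ {s τ f γ Γ} → (∀ t → sub τ (f t) ≡ sub s t) →
        s ⊨ Γ at γ → τ ⊨ map (mapTmᵃ f) Γ at γ
⊨-map {γ = γ} eq = map⁺ ∘ mapAll λ {φ} → subst (Holds γ) (sym (mapTmᵃ-∘ eq φ))

-- Semantic form of the side condition of `∀I`: the shifted types never look up the new head `r`.
⊨-shiftᵗ : ∀ {s r γ Γ} → s ⊨ Γ at γ → s ⊨ shiftᵗ Γ at (just r ∷ γ)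
⊨-shiftᵗ {s} {r} {γ} = map⁺ ∘ mapAll λ {φ} h →
  subst (λ R → ⟦ R ⟧ (just r ∷ γ) (sub s (left φ)) (sub s (right φ)))
    (sym (mapTm-renᵗ (sub s) suc (type φ)))
    (⟦renᵗ⟧ (λ _ → refl) (mapTm (sub s) (type φ)) _ _ .from h)

sub-shift₁ : ∀ {u s} t → sub (u ∙ s) (shift 1 t) ≡ sub s t
sub-shift₁ = sub-ren λ _ → refl

sub-shift₂ : ∀ {u v s} t → sub (u ∙ v ∙ s) (shift 2 t) ≡ sub s t
sub-shift₂ t = trans (sub-shift₁ (ren suc t)) (sub-shift₁ t)

module _ (resize : Resizing) where

  -- Impredicativity enters here: a type is interpreted in `Set₁`, while elements of `𝓡` are
  -- relations in `Set`. Closure carries over to the resized copy from `⟦⟧-resp`.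
  ⟦_⟧ᵣ : Ty → Env → 𝓡
  ⟦ R ⟧ᵣ γ = rel , respʳ , respˡ
    where
    rel : Rel Term 0ℓ
    rel t t′ = proj₁ (resize (⟦ R ⟧ γ t t′))
    small : ∀ {t t′} → ⟦ R ⟧ γ t t′ ⇔ rel t t′
    small = proj₂ (resize _)
    respʳ : ∀ {t u u′} → u =βη u′ → rel t u → rel t u′
    respʳ p = small .to ∘ ⟦⟧-resp R γ (reflexive _⟶_) p ∘ small .from
    respˡ : ∀ {t u u′} → u =βη u′ → rel u t → rel u′ t
    respˡ p = small .to ∘ ⟦⟧-resp R γ p (reflexive _⟶_) ∘ small .from

  ⟦[0≔]ᵗ⟧ : ∀ S R γ → ⟦ R [0≔ S ]ᵗ ⟧ γ ≃ ⟦ R ⟧ (just (⟦ S ⟧ᵣ γ) ∷ γ)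
  ⟦[0≔]ᵗ⟧ S R γ = ⟦subᵗ⟧ (λ where
    zero    t t′ → mk⇔ (lift ∘ resize (⟦ S ⟧ γ t t′) .proj₂ .to)
                       (resize (⟦ S ⟧ γ t t′) .proj₂ .from ∘ lower)
    (suc X) t t′ → mk⇔ (lift ∘ lower) (lift ∘ lower)) R

  -- Quantifying `s` and `γ` after the derivation gives an induction hypothesis at extended ones:
  -- `⇒I` and `⨾E` extend `s`, `∀I` extends `γ`.
  sound : ∀ {Γ φ} → Γ ⊢ φ → ∀ {s γ} → s ⊨ Γ at γ → Holds γ (mapTmᵃ (sub s) φ)
  sound (assume φ∈Γ) h = lookup h φ∈Γ
  sound (⇒I {t} {t′} {R} {R′} d) {s} {γ} h a a′ r =
    ⟦⟧-resp (mapTm (sub s) R′) γ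
      -- Under `σ`, `ren suc t` skips `a′` and sends index 0 of `t` to `a`, while
      -- `ren (extʳ suc) t′` skips `a` and sends index 0 of `t′` to `a′`. A β-expansion then yields
      -- the two applications.
      (expand t  (sub-ren (λ { zero → refl ; (suc _) → refl }) t))
      (expand t′ (sub-ren (λ { zero → refl ; (suc _) → refl }) t′))
      (subst (λ S → ⟦ S ⟧ γ (sub σ (ren suc t)) (sub σ (ren (extʳ suc) t′)))
        (mapTm-∘ sub-shift₂ R′)
        (sound d
          (subst (λ S → ⟦ S ⟧ γ a a′) (sym (mapTm-∘ sub-shift₂ R)) r ∷ ⊨-map sub-shift₂ h)))
    where
    -- The order matches the premise of `⇒I`: the left variable is index 1, the right one index 0.
    σ = a′ ∙ a ∙ s
    expand : ∀ t {b v} → v ≡ sub (b ∙ s) t → v =βη sub s (ƛ t) · b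
    expand t {b} eq = transitive _⟶_
      (≡⇒=βη (trans eq (sym (sub-exts-[0≔] s b t)))) (symmetric _⟶_ (return (β {sub (exts s) t})))
  sound (⇒E d e) h = sound d h _ _ (sound e h)
  sound (∀E {t} {t′} {R′} R d) {s} {γ} h =
    subst (λ S → ⟦ S ⟧ γ (sub s t) (sub s t′)) (sym (mapTm-[0≔]ᵗ (sub s) R R′))
      (⟦[0≔]ᵗ⟧ (mapTm (sub s) R) (mapTm (sub s) R′) γ _ _ .from
        -- The quantifier is instantiated at the interpretation of the substituted type `R`.
        (sound d h (⟦ mapTm (sub s) R ⟧ᵣ γ)))
  sound (∀I d) h r = sound d (⊨-shiftᵗ h)
  sound (conv {R = R} d p q) {s} {γ} h =
    ⟦⟧-resp (mapTm (sub s) R) γ (sub-=βη s p) (sub-=βη s q) (sound d h)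
  sound (˘I d) h = sound d h
  sound (˘E d) h = sound d h
  sound ⌜⌝I h = lift (reflexive _⟶_)
  sound (⌜⌝E {t} {t′} {t″} {R} t₁ t₂ d e) {s} {γ} h =
    ⟦⟧-resp (mapTm (sub s) R) γ (replace t₁) (replace t₂) (sound e h)
    where
    replace : ∀ u → sub s (u [0≔ t′ ]) =βη sub s (u [0≔ t″ · t ])
    replace u = transitive _⟶_ (≡⇒=βη (sub-[0≔] s t′ u))
      (transitive _⟶_
        -- The first premise, interpreted, is the conversion `t″ · t =βη t′` under `s`; it is read
        -- from right to left.
        ([0≔]-cong (sub (exts s) u) (symmetric _⟶_ (lower (sound d h))))
        (≡⇒=βη (sym (sub-[0≔] s (t″ · t) u))))
  sound (⨾E {t} {t′} {t₁} {t₂} {R} {R′} {R″} d e) {s} {γ} h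
    with m , l , r ← sound d h =
    subst (Holds γ) (mapTmᵃ-∘ sub-shift₁ (t₁ [ R″ ] t₂))
      -- The fresh variable of `⨾E` is sent to the semantic midpoint `m`.
      (sound e {m ∙ s}
        ( subst₂ (λ S u → ⟦ S ⟧ γ m u)
            (sym (mapTm-∘ sub-shift₁ R′)) (sym (sub-shift₁ t′)) r
        ∷ subst₂ (λ S u → ⟦ S ⟧ γ u m)
            (sym (mapTm-∘ sub-shift₁ R)) (sym (sub-shift₁ t)) l
        ∷ ⊨-map sub-shift₁ h))
  sound (⨾I d e) h = _ , sound d h , sound e h

mainTheorem4 : Resizing →
    ∀ (Γ : Ctx) (t t′ : Term) (R : Ty) (γ : Env) (σ : TermSubst) →
    All (λ φ → γ defined-on type φ) Γ →
    γ defined-on R →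
    Γ ⊢ t [ R ] t′ →
    σ ∈⟦ Γ ⟧ γ →
    ⟦ σ $ᵀ R ⟧ γ (σ $ₜ t) (σ $ₜ t′)
-- A finite `σ` acts as `sub` of a total function that fixes the variables outside its domain, so
-- `sound` applies by computation.
mainTheorem4 resize Γ t t′ R γ σ _ _ d h = sound resize d h
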